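{- Let $M=(S,v)$ be a model for the logic LP, let $\varphi$ be a well-formed formula, and let $\Gamma_{\mathrm{LP}}(M,\varphi)$ be the LP semantic game. Then: \begin{itemize} \item Verifier has a dominant winning strategy in $\Gamma_{\mathrm{LP}}(M,\varphi)$ if and only if $\varphi$ is true in $M$ (has value $T$); \item Falsifier has a dominant winning strategy in $\Gamma_{\mathrm{LP}}(M,\varphi)$ if and only if $\varphi$ is false in $M$ (has value $F$); \item Paradoxifier has a dominant winning strategy in $\Gamma_{\mathrm{LP}}(M,\varphi)$ if and only if $\varphi$ is paradoxical in $M$ (has value $P$). \end{itemize}
   Context: Formulas: $\varphi := p \mid \neg\varphi \mid \varphi\wedge\varphi \mid \varphi\vee\varphi$, with $p$ in a countable set $\mathbf{P}$ of propositional variables (atoms). Logic LP (Priest's Logic of Paradox): truth values $T$ (true), $P$ (paradoxical), $F$ (false). Negation: $\neg T=F$, $\neg F=T$, $\neg P=P$. With the order $F<P<T$, the value of a conjunction is the minimum and the value of a disjunction is the maximum of the values of its two components. A model is $M=(S,v)$, where $S$ is a non-empty domain and $v$ is a valuation assigning truth values to formulas: arbitrary values on atoms, extended to all formulas by these tables. Game $\Gamma_{\mathrm{LP}}(M,\varphi)$: there are three players, starting in the roles Verifier, Falsifier, Paradoxifier. Rules (given for roles): (atoms) if $\varphi$ is atomic, the game terminates; Verifier wins if $\varphi$ is true, Falsifier wins if it is false, Paradoxifier wins if it is paradoxical. (negation) if $\varphi=\neg\psi$, Verifier and Falsifier switch roles, Paradoxifier keeps his role, and the game continues as $\Gamma_{\mathrm{LP}}(M,\psi)$.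 (conjunction) if $\varphi=\chi\wedge\psi$, Falsifier and Paradoxifier choose between $\chi$ and $\psi$ simultaneously (and independently). (disjunction) if $\varphi=\chi\vee\psi$, Verifier and Paradoxifier choose between $\chi$ and $\psi$ simultaneously (and independently). (domination) Paradoxifier's strategy is strictly dominated by Verifier's and by Falsifier's (there is no domination between Verifier and Falsifier). Winning strategies: where a player (in the current role) is entitled to choose, the player continues at the component he or she chose, whatever the simultaneous mover chooses; where a player is not entitled to choose, play may continue at either component. A player has a winning strategy if he or she has a system of choices such that every atom that can be reached in this way is a win for that player in the role held there. "Verifier (Falsifier, Paradoxifier) has a winning strategy in $\Gamma_{\mathrm{LP}}(M,\varphi)$" refers to the player holding that role at the start. A dominant winning strategy is a winning strategy that determines the truth value of $\varphi$ once played; in view of the domination rule: a winning strategy of a player is dominant if no player whose strategies strictly dominate that player's strategies has a winning strategy in the same game. So every winning strategy of Verifier or of Falsifier is dominant, and a winning strategy of Paradoxifier is dominant exactly when neither Verifier nor Falsifier has a winning strategy. -}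

module Defs where

open import Data.Nat using (ℕ)
open import Data.Product using (∃; _×_)
open import Function using (id; _∘_)
open import Function.Bundles using (_↣_)
open import Relation.Binary.PropositionalEquality using (_≡_)
open import Relation.Nullary using (¬_)

-- Finite and countably infinite sets alike.
Countable : Set → Set
Countable A = A ↣ ℕ

infix  8 ∼_
infixr 7 _∧_
infixr 6 _∨_

data Formula (Atom : Set) : Set where
  atom : Atom → Formula Atom
  ∼_   : Formula Atom → Formula Atom
  _∧_  : Formula Atom → Formula Atom → Formula Atom
  _∨_  : Formula Atom → Formula Atom → Formula Atom

data Truth : Set where
  T P F : Truth

neg : Truth → Truth
neg T = F
neg P = P
neg F = T

-- Minimum and maximum for the order F < P < T.
min : Truth → Truth → Truth
min T y = y
min F y = F
min P T = P
min P P = P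
min P F = F

max : Truth → Truth → Truth
max T y = T
max F y = y
max P T = T
max P P = P
max P F = P

record Model (Atom : Set) : Set₁ where
  field
    S        : Set
    nonEmpty : S
    v        : Atom → Truth

  value : Formula Atom → Truth
  value (atom p) = v p
  value (∼ φ)    = neg (value φ)
  value (φ ∧ ψ)  = min (value φ) (value ψ)
  value (φ ∨ ψ)  = max (value φ) (value ψ)

data Role : Set where
  Verifier Falsifier Paradoxifier : Role

-- A player is named by the role he or she holds at the start of the game.
Player : Set
Player = Role

switch : Role → Role
switch Verifier     = Falsifier
switch Falsifier    = Verifier
switch Paradoxifier = Paradoxifier

winningRole : Truth → Role
winningRole T = Verifier
winningRole P = Paradoxifier
winningRole F = Falsifier

data Side : Set where
  left right : Side

pick : {A : Set} → Side → A → A → A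
pick left  x y = x
pick right x y = y

data Entitled {Atom : Set} : Role → Formula Atom → Set where
  falsifier-∧    : ∀ {χ ψ} → Entitled Falsifier    (χ ∧ ψ)
  paradoxifier-∧ : ∀ {χ ψ} → Entitled Paradoxifier (χ ∧ ψ)
  verifier-∨     : ∀ {χ ψ} → Entitled Verifier     (χ ∨ ψ)
  paradoxifier-∨ : ∀ {χ ψ} → Entitled Paradoxifier (χ ∨ ψ)

-- X StrictlyDominates Y: the strategies of X strictly dominate those of Y.
-- The relation is invariant under switch, so it makes no difference whether
-- it is read for roles or for the players holding them at the start.
data _StrictlyDominates_ : Player → Player → Set where
  verifier-paradoxifier  : Verifier  StrictlyDominates Paradoxifier
  falsifier-paradoxifier : Falsifier StrictlyDominates Paradoxifier

module Γ-LP {Atom : Set} (M : Model Atom) (φ : Formula Atom) where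
  open Model M using (v)

  -- Position ψ ρ: the histories of play from φ that arrive at an occurrence of
  -- the subformula ψ, with ρ giving the role each player now holds.
  data Position : Formula Atom → (Player → Role) → Set where
    start       : Position φ id
    negation    : ∀ {ψ ρ} → Position (∼ ψ) ρ → Position ψ (switch ∘ ρ)
    conjunction : ∀ {χ ψ ρ} → Position (χ ∧ ψ) ρ →
                  (s : Side) → Position (pick s χ ψ) ρ
    disjunction : ∀ {χ ψ ρ} → Position (χ ∨ ψ) ρ →
                  (s : Side) → Position (pick s χ ψ) ρ

  -- The choice depends on the history only, not on what the other entitled
  -- player simultaneously chooses.
  Strategy : Player → Set
  Strategy π = ∀ {ψ ρ} → Position ψ ρ → Entitled (ρ π) ψ → Side

  -- The positions that can be reached when π follows σ.  The last argument of
  -- conjunction and disjunction forces the chosen side if π is entitled to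
  -- choose, and is vacuous (either side may follow) if π is not.
  data Reachable (π : Player) (σ : Strategy π) :
                 ∀ {ψ ρ} → Position ψ ρ → Set where
    start       : Reachable π σ start
    negation    : ∀ {ψ ρ} {p : Position (∼ ψ) ρ} →
                  Reachable π σ p → Reachable π σ (negation p)
    conjunction : ∀ {χ ψ ρ} {p : Position (χ ∧ ψ) ρ} → Reachable π σ p →
                  (s : Side) → ((e : Entitled (ρ π) (χ ∧ ψ)) → σ p e ≡ s) →
                  Reachable π σ (conjunction p s)
    disjunction : ∀ {χ ψ ρ} {p : Position (χ ∨ ψ) ρ} → Reachable π σ p →
                  (s : Side) → ((e : Entitled (ρ π) (χ ∨ ψ)) → σ p e ≡ s) →
                  Reachable π σ (disjunction p s)

  Winning : (π : Player) → Strategy π → Set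
  Winning π σ = ∀ {a ρ} (p : Position (atom a) ρ) →
                Reachable π σ p → ρ π ≡ winningRole (v a)

  HasWinningStrategy : Player → Set
  HasWinningStrategy π = ∃ λ (σ : Strategy π) → Winning π σ

  DominantWinning : (π : Player) → Strategy π → Set
  DominantWinning π σ =
    Winning π σ × (∀ π′ → π′ StrictlyDominates π → ¬ HasWinningStrategy π′)

  HasDominantWinningStrategy : Player → Set
  HasDominantWinningStrategy π = ∃ λ (σ : Strategy π) → DominantWinning π σ

{-# OPTIONS --safe #-}
-- A role wants one truth value.  A player who always moves to a component
-- attaining the minimum (∧) or maximum (∨) preserves the property that the
-- current subformula has the value wanted by his or her role: where the player
-- has no choice the value is extremal, so both components have it.  Conversely,
-- a winning strategy of Verifier or Falsifier forces the wanted value, by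
-- induction on the formula.  This fails for Paradoxifier, who can win at P ∧ F
-- and P ∨ T, but in these cases Falsifier or Verifier wins too, so Paradoxifier's
-- strategy is not dominant.
module Submission where

open import Defs
open import Data.Empty using (⊥-elim)
open import Data.Product using (∃; _×_; _,_; proj₁; proj₂)
open import Function.Bundles using (_⇔_; mk⇔)
open import Relation.Binary.PropositionalEquality
  using (_≡_; _≢_; refl; sym; trans; cong; cong₂)
open import Relation.Nullary using (¬_)

-- Inverse of `winningRole`. It turns a win at an atom into an equation of truth values, which
-- `neg`, `min` and `max` can transport.
wanted : Role → Truth
wanted Verifier     = T
wanted Falsifier    = F
wanted Paradoxifier = P

wanted-winningRole : ∀ x → wanted (winningRole x) ≡ x
wanted-winningRole T = refl
wanted-winningRole P = refl
wanted-winningRole F = refl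

winningRole-wanted : ∀ r → winningRole (wanted r) ≡ r
winningRole-wanted Verifier     = refl
winningRole-wanted Falsifier    = refl
winningRole-wanted Paradoxifier = refl

wanted-switch : ∀ r → wanted (switch r) ≡ neg (wanted r)
wanted-switch Verifier     = refl
wanted-switch Falsifier    = refl
wanted-switch Paradoxifier = refl

switch-involutive : ∀ r → switch (switch r) ≡ r
switch-involutive Verifier     = refl
switch-involutive Falsifier    = refl
switch-involutive Paradoxifier = refl

neg-involutive : ∀ x → neg (neg x) ≡ x
neg-involutive T = refl
neg-involutive P = refl
neg-involutive F = refl

min-sel : ∀ x y → ∃ λ s → pick s x y ≡ min x y
min-sel T y = right , refl
min-sel F y = left  , refl
min-sel P T = left  , refl
min-sel P P = left  , refl
min-sel P F = right , refl

max-sel : ∀ x y → ∃ λ s → pick s x y ≡ max x y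
max-sel T y = left  , refl
max-sel F y = right , refl
max-sel P T = right , refl
max-sel P P = left  , refl
max-sel P F = left  , refl

-- `T` is the greatest value. This serves Verifier, who has no move at a conjunction.
min≡T⇒pick≡T : ∀ s x y → min x y ≡ T → pick s x y ≡ T
min≡T⇒pick≡T left  T y eq = refl
min≡T⇒pick≡T right T y eq = eq
min≡T⇒pick≡T s     P T ()
min≡T⇒pick≡T s     P P ()
min≡T⇒pick≡T s     P F ()
min≡T⇒pick≡T left  F T ()
min≡T⇒pick≡T right F T ()

max≡F⇒pick≡F : ∀ s x y → max x y ≡ F → pick s x y ≡ F
max≡F⇒pick≡F left  F y eq = refl
max≡F⇒pick≡F right F y eq = eq
max≡F⇒pick≡F s     P T ()
max≡F⇒pick≡F s     P P ()
max≡F⇒pick≡F s     P F ()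

-- `F` is the least value, so one component decides. The analogue for `P` fails: `min P F` is `F`.
pick≡F⇒min≡F : ∀ s x y → pick s x y ≡ F → min x y ≡ F
pick≡F⇒min≡F left  F y refl = refl
pick≡F⇒min≡F right T F refl = refl
pick≡F⇒min≡F right P F refl = refl
pick≡F⇒min≡F right F F refl = refl

pick≡T⇒max≡T : ∀ s x y → pick s x y ≡ T → max x y ≡ T
pick≡T⇒max≡T left  T y refl = refl
pick≡T⇒max≡T right T T refl = refl
pick≡T⇒max≡T right P T refl = refl
pick≡T⇒max≡T right F T refl = refl

module _ {Atom : Set} (M : Model Atom) where
  open Model M using (v; value)

  -- `value` is stuck on `pick s χ ψ` while `s` is a variable.
  value-pick : ∀ s χ ψ → value (pick s χ ψ) ≡ pick s (value χ) (value ψ)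
  value-pick left  χ ψ = refl
  value-pick right χ ψ = refl

  ∧-side ∨-side : Formula Atom → Formula Atom → Side
  ∧-side χ ψ = proj₁ (min-sel (value χ) (value ψ))
  ∨-side χ ψ = proj₁ (max-sel (value χ) (value ψ))

  value-∧-side : ∀ χ ψ → value (pick (∧-side χ ψ) χ ψ) ≡ value (χ ∧ ψ)
  value-∧-side χ ψ =
    trans (value-pick (∧-side χ ψ) χ ψ) (proj₂ (min-sel (value χ) (value ψ)))

  value-∨-side : ∀ χ ψ → value (pick (∨-side χ ψ) χ ψ) ≡ value (χ ∨ ψ)
  value-∨-side χ ψ =
    trans (value-pick (∨-side χ ψ) χ ψ) (proj₂ (max-sel (value χ) (value ψ)))

  ∧-preserves : ∀ r χ ψ s → (Entitled r (χ ∧ ψ) → ∧-side χ ψ ≡ s) →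
                value (χ ∧ ψ) ≡ wanted r → value (pick s χ ψ) ≡ wanted r
  ∧-preserves Verifier χ ψ s _ eq =
    trans (value-pick s χ ψ) (min≡T⇒pick≡T s (value χ) (value ψ) eq)
  ∧-preserves Falsifier χ ψ s f eq with refl ← f falsifier-∧ =
    trans (value-∧-side χ ψ) eq
  ∧-preserves Paradoxifier χ ψ s f eq with refl ← f paradoxifier-∧ =
    trans (value-∧-side χ ψ) eq

  ∨-preserves : ∀ r χ ψ s → (Entitled r (χ ∨ ψ) → ∨-side χ ψ ≡ s) →
                value (χ ∨ ψ) ≡ wanted r → value (pick s χ ψ) ≡ wanted r
  ∨-preserves Falsifier χ ψ s _ eq =
    trans (value-pick s χ ψ) (max≡F⇒pick≡F s (value χ) (value ψ) eq)
  ∨-preserves Verifier χ ψ s f eq with refl ← f verifier-∨ =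
    trans (value-∨-side χ ψ) eq
  ∨-preserves Paradoxifier χ ψ s f eq with refl ← f paradoxifier-∨ =
    trans (value-∨-side χ ψ) eq

  -- `c` stands for the strategy's choice at one position, and the hypothesis after it for the
  -- induction hypothesis at every side that this choice leaves reachable.
  ∧-reflects : ∀ r χ ψ → r ≢ Paradoxifier → (c : Entitled r (χ ∧ ψ) → Side) →
               (∀ s → (∀ e → c e ≡ s) → value (pick s χ ψ) ≡ wanted r) →
               value (χ ∧ ψ) ≡ wanted r
  ∧-reflects Verifier χ ψ _ c h =
    -- Verifier is not entitled here, so the constraint is vacuous and both sides are reachable.
    cong₂ min (h left (λ ())) (h right (λ ()))
  ∧-reflects Falsifier χ ψ _ c h =
    pick≡F⇒min≡F s (value χ) (value ψ)
      (trans (sym (value-pick s χ ψ)) (h s λ { falsifier-∧ → refl }))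
    where s = c falsifier-∧
  ∧-reflects Paradoxifier χ ψ r≢P c h = ⊥-elim (r≢P refl)

  ∨-reflects : ∀ r χ ψ → r ≢ Paradoxifier → (c : Entitled r (χ ∨ ψ) → Side) →
               (∀ s → (∀ e → c e ≡ s) → value (pick s χ ψ) ≡ wanted r) →
               value (χ ∨ ψ) ≡ wanted r
  ∨-reflects Falsifier χ ψ _ c h =
    cong₂ max (h left (λ ())) (h right (λ ()))
  ∨-reflects Verifier χ ψ _ c h =
    pick≡T⇒max≡T s (value χ) (value ψ)
      (trans (sym (value-pick s χ ψ)) (h s λ { verifier-∨ → refl }))
    where s = c verifier-∨
  ∨-reflects Paradoxifier χ ψ r≢P c h = ⊥-elim (r≢P refl)

  module _ (φ : Formula Atom) where
    open Γ-LP M φ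

    -- The move depends on the current formula alone and is the same for all three players.
    optimal : ∀ π → Strategy π
    optimal π {χ ∧ ψ} _ _ = ∧-side χ ψ
    optimal π {χ ∨ ψ} _ _ = ∨-side χ ψ
    optimal π {atom _} _ ()
    optimal π {∼ _}    _ ()

    optimal-invariant : ∀ π → value φ ≡ wanted π →
                        ∀ {ψ ρ} {p : Position ψ ρ} →
                        Reachable π (optimal π) p → value ψ ≡ wanted (ρ π)
    optimal-invariant π eq start = eq
    optimal-invariant π eq {ψ} (negation {ρ = ρ} reach) =
      -- The induction hypothesis concerns `∼ ψ`; applying `neg` to both sides cancels the negation
      -- on the left and switches the role on the right.
      trans (sym (neg-involutive (value ψ)))
        (trans (cong neg (optimal-invariant π eq reach))
          (sym (wanted-switch (ρ π))))
    optimal-invariant π eq (conjunction {χ} {ψ} {ρ} reach s f) =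
      ∧-preserves (ρ π) χ ψ s f (optimal-invariant π eq reach)
    optimal-invariant π eq (disjunction {χ} {ψ} {ρ} reach s f) =
      ∨-preserves (ρ π) χ ψ s f (optimal-invariant π eq reach)

    optimal-winning : ∀ π → value φ ≡ wanted π → Winning π (optimal π)
    optimal-winning π eq {ρ = ρ} p reach =
      trans (sym (winningRole-wanted (ρ π)))
        (cong winningRole (sym (optimal-invariant π eq reach)))

    -- Stated for all reachable positions so that induction on `ψ` can follow the play through role
    -- switches; `switch` never leads into Paradoxifier from another role.
    winning-reachable : ∀ {π} {σ : Strategy π} → Winning π σ →
                        ∀ ψ {ρ} {p : Position ψ ρ} → Reachable π σ p →
                        ρ π ≢ Paradoxifier → value ψ ≡ wanted (ρ π)
    winning-reachable win (atom a) reach _ =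
      trans (sym (wanted-winningRole (v a))) (cong wanted (sym (win _ reach)))
    winning-reachable {π} win (∼ ψ) {ρ} reach r≢P =
      trans (cong neg (winning-reachable win ψ (negation reach) switch≢P))
        (trans (cong neg (wanted-switch (ρ π))) (neg-involutive (wanted (ρ π))))
      where
      switch≢P : switch (ρ π) ≢ Paradoxifier
      switch≢P eq = r≢P (trans (sym (switch-involutive (ρ π))) (cong switch eq))
    winning-reachable {π} {σ} win (χ ∧ ψ) {ρ} {p} reach r≢P =
      -- Splitting on the side reduces `pick` to `χ` or `ψ`, which makes the recursive calls
      -- structural.
      ∧-reflects (ρ π) χ ψ r≢P (σ p) λ where
        left  f → winning-reachable win χ (conjunction reach left f) r≢P
        right f → winning-reachable win ψ (conjunction reach right f) r≢P
    winning-reachable {π} {σ} win (χ ∨ ψ) {ρ} {p} reach r≢P =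
      ∨-reflects (ρ π) χ ψ r≢P (σ p) λ where
        left  f → winning-reachable win χ (disjunction reach left f) r≢P
        right f → winning-reachable win ψ (disjunction reach right f) r≢P

    winning⇒value : ∀ π → π ≢ Paradoxifier →
                    HasWinningStrategy π → value φ ≡ wanted π
    winning⇒value π π≢P (σ , win) = winning-reachable win φ start π≢P

    value⇒winning : ∀ π → value φ ≡ wanted π → HasWinningStrategy π
    value⇒winning π eq = optimal π , optimal-winning π eq

    dominant⇒value : ∀ π → HasDominantWinningStrategy π → value φ ≡ wanted π
    dominant⇒value Verifier  (σ , win , _) = winning⇒value Verifier  (λ ()) (σ , win)
    dominant⇒value Falsifier (σ , win , _) = winning⇒value Falsifier (λ ()) (σ , win)
    -- Either value other than `P` would give a dominating player the winning strategy `optimal`.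
    dominant⇒value Paradoxifier (σ , win , undominated) with value φ in eq
    ... | P = refl
    ... | T = ⊥-elim (undominated Verifier verifier-paradoxifier
                       (value⇒winning Verifier eq))
    ... | F = ⊥-elim (undominated Falsifier falsifier-paradoxifier
                       (value⇒winning Falsifier eq))

    value⇒dominant : ∀ π → value φ ≡ wanted π → HasDominantWinningStrategy π
    value⇒dominant π eq = optimal π , optimal-winning π eq , undominated eq
      where
      -- `π` is quantified afresh so that matching on the domination can set it to Paradoxifier; a
      -- win of the dominating player would then equate `P` with `T` or `F`.
      undominated : ∀ {π} → value φ ≡ wanted π →
                    ∀ π′ → π′ StrictlyDominates π → ¬ HasWinningStrategy π′
      undominated eq _ verifier-paradoxifier w
        with () ← trans (sym eq) (winning⇒value Verifier (λ ()) w)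
      undominated eq _ falsifier-paradoxifier w
        with () ← trans (sym eq) (winning⇒value Falsifier (λ ()) w)

    dominant⇔value : ∀ π → HasDominantWinningStrategy π ⇔ value φ ≡ wanted π
    dominant⇔value π = mk⇔ (dominant⇒value π) (value⇒dominant π)

theorem5p4 : (Atom : Set) → Countable Atom →
    (M : Model Atom) (φ : Formula Atom) →
    (Γ-LP.HasDominantWinningStrategy M φ Verifier ⇔ Model.value M φ ≡ T) ×
    (Γ-LP.HasDominantWinningStrategy M φ Falsifier ⇔ Model.value M φ ≡ F) ×
    (Γ-LP.HasDominantWinningStrategy M φ Paradoxifier ⇔ Model.value M φ ≡ P)
theorem5p4 Atom _ M φ =
  dominant⇔value M φ Verifier ,
  dominant⇔value M φ Falsifier ,
  dominant⇔value M φ Paradoxifier
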